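{- Let $G$ be a graph of order $n$ and size $m$. If the Seidel matrix of $G$ is singular, then $$m+n_{odd}\equiv \frac{n-1}{4}\pmod 4,$$ where $n_{odd}$ is the number of vertices of $G$ of odd degree.
   Context: All graphs are simple, undirected, finite, with at least one vertex. The order of a graph is its number of vertices and its size is its number of edges. For a graph $G$ with vertices $v_1,\dots,v_n$ and adjacency matrix $A$, the Seidel matrix of $G$ is $S=J_n-I_n-2A$, where $J_n$ is the all-ones $n\times n$ matrix and $I_n$ the identity. If the Seidel matrix of a graph of order $n$ is singular, then $n\equiv 1\pmod 4$, so $\frac{n-1}{4}$ is an integer and the congruence is between integers. -}

module Defs where

open import Level using (0ℓ)
open import Data.Bool.Base using (if_then_else_)
open import Data.Nat.Base as ℕ using (ℕ; zero; suc)
import Data.Nat.Properties as ℕ using (_≟_)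
open import Data.Integer.Base using (ℤ; 0ℤ; 1ℤ; -1ℤ; +_; _-_; _*_; _^_)
open import Data.Integer.Properties using (+-0-commutativeMonoid)
open import Data.Fin.Base using (Fin; zero; suc; toℕ; punchIn; _<_)
open import Data.Fin.Properties using (_≟_; _<?_)
open import Data.List.Base using (List; length; filter; allFin; cartesianProduct)
open import Data.Product.Base using (_×_; _,_)
open import Relation.Binary.Core using (Rel)
open import Relation.Binary.Definitions using (Symmetric; Irreflexive; Decidable)
open import Relation.Binary.PropositionalEquality using (_≡_)
open import Relation.Nullary.Decidable using (does; _×-dec_)

open import Algebra.Properties.CommutativeMonoid.Sum +-0-commutativeMonoid public
  using (sum)

Matrix : ℕ → Set
Matrix n = Fin n → Fin n → ℤ

minor : ∀ {n} → Matrix (suc n) → Fin (suc n) → Matrix n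
minor M j i k = M (suc i) (punchIn j k)

-- Laplace expansion along the first row.
det : ∀ {n} → Matrix n → ℤ
det {zero}  M = 1ℤ
det {suc n} M = sum λ j → -1ℤ ^ toℕ j * (M zero j * det (minor M j))

Singular : ∀ {n} → Matrix n → Set
Singular M = det M ≡ 0ℤ

-- Simple undirected graphs on the vertex set Fin n.  Adjacency is taken to be
-- decidable, as it is classically, so that edges can be counted.
record Graph (n : ℕ) : Set₁ where
  infix 4 _~_ _~?_
  field
    _~_    : Rel (Fin n) 0ℓ
    sym    : Symmetric _~_
    irrefl : Irreflexive _≡_ _~_
    _~?_   : Decidable _~_

  -- Each edge {i , j} is listed once, as the pair with i < j.
  edges : List (Fin n × Fin n)
  edges = filter (λ (i , j) → (i <? j) ×-dec (i ~? j))
                 (cartesianProduct (allFin n) (allFin n))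

  size : ℕ
  size = length edges

  degree : Fin n → ℕ
  degree i = length (filter (i ~?_) (allFin n))

  oddVertices : List (Fin n)
  oddVertices = filter (λ i → degree i ℕ.% 2 ℕ.≟ 1) (allFin n)

  n-odd : ℕ
  n-odd = length oddVertices

  adjacency : Matrix n
  adjacency i j = if does (i ~? j) then 1ℤ else 0ℤ

allOnes : ∀ n → Matrix n
allOnes n i j = 1ℤ

identity : ∀ n → Matrix n
identity n i j = if does (i ≟ j) then 1ℤ else 0ℤ

seidel : ∀ {n} → Graph n → Matrix n
seidel {n} G i j = allOnes n i j - identity n i j - + 2 * Graph.adjacency G i j

module Submission where

-- A singular integer matrix has a nonzero integer kernel vector (column elimination), and after
-- halving one with an odd entry.  If S x = 0 for the Seidel matrix S = J − I − 2A and s is the sum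
-- of the entries of x, then x = s 1 − 2 A x, so s is odd.  Substituting this equation into itself
-- and summing entries gives, with d = A 1 the degree vector,
--   s ≡ s (n − 2 Σ dᵢ + 4 Σ dᵢ² − 8 dᵀ A d)   (mod 16).
-- Cancel s; Σ dᵢ = 2 m, dᵀ A d is even, and dᵢ² ≡ 2 dᵢ − (dᵢ mod 2) (mod 4), which leaves
-- n − 1 ≡ 4 (m + n_odd) (mod 16).

open import Defs
open import Data.Bool.Base using (true; false; if_then_else_)
open import Data.Nat.Base as ℕ using (ℕ; zero; suc; NonZero; _∸_; _%_)
import Data.Nat.Properties as ℕ
open import Data.Nat.Divisibility using (_∣_; quotient)
open import Data.Nat.DivMod using (m≡m%n+[m/n]*n; m%n<n; [m+kn]%n≡m%n)
open import Data.Integer.Base using (ℤ; +_; -[1+_]; 0ℤ; 1ℤ; -1ℤ; _+_; _-_; _*_; -_; _^_; ∣_∣)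
open import Data.Integer.Properties
  using ( _≟_; +-0-commutativeMonoid; +-*-semiring; +-identityˡ; +-identityʳ
        ; *-identityˡ; *-identityʳ; *-zeroʳ; *-comm; *-cancelˡ-≡; *-cancelʳ-≡
        ; -1*i≡-i; neg-distribʳ-*; neg-injective; i*j≡0⇒i≡0∨j≡0
        ; pos-+; pos-*; abs-*; +-injective; ∣i∣≡0⇒i≡0 )
open import Data.Integer.DivMod using (_%ℕ_; _/ℕ_; n%ℕd<d; a≡a%ℕn+[a/ℕn]*n)
open import Data.Integer.Divisibility.Signed using (divides; ∣⇒∣ᵤ)
open import Data.Integer.Tactic.RingSolver using (solve-∀)
open import Data.Fin.Base using (Fin; zero; suc; toℕ; inject₁; punchIn; punchOut)
open import Data.Fin.Properties
  using (_<?_; <-cmp; punchIn-punchOut; punchInᵢ≢i; punchIn-injective; any?)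
  renaming (_≟_ to _≟ᶠ_)
open import Data.Fin.Induction using (<-weakInduction)
open import Data.List.Base
  using ([]; _∷_; length; filter; map; _++_; tabulate; allFin; cartesianProduct)
open import Data.List.Properties using (length-++; filter-++; map-tabulate)
open import Data.List.Membership.Propositional using (_∈_)
open import Data.List.Membership.Propositional.Properties using (∈-allFin)
open import Data.List.Relation.Unary.Any using (here; there)
open import Data.Product.Base using (Σ-syntax; ∃-syntax; _×_; _,_; proj₁; proj₂)
open import Data.Sum.Base using (_⊎_; inj₁; inj₂)
open import Data.Vec.Functional using (updateAt)
open import Data.Vec.Functional.Properties using (updateAt-updates; updateAt-minimal)
open import Function.Base using (_∘_; const; id)
open import Function.Bundles using (mk⇔)
open import Relation.Binary.Definitions using (tri<; tri≈; tri>)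
open import Relation.Binary.PropositionalEquality
open import Relation.Nullary using (Dec; does; yes; no; contradiction; ¬?)
open import Relation.Nullary.Decidable
  using (dec-true; dec-false; decidable-stable; does-⇔; _×-dec_)
open import Relation.Unary using (Decidable)
open import Algebra.Properties.CommutativeMonoid.Sum +-0-commutativeMonoid
  using (sum-cong-≗; sum-replicate-zero; ∑-distrib-+; ∑-comm)
open import Algebra.Properties.Semiring.Sum +-*-semiring using (*-distribˡ-sum)
open ≡-Reasoning

private variable
  m n : ℕ

-- Linearity of sums, and of the determinant in each column.

sum-linear : ∀ a b (f g : Fin n → ℤ) →
             sum (λ i → a * f i + b * g i) ≡ a * sum f + b * sum g
sum-linear a b f g = begin
  sum (λ i → a * f i + b * g i)           ≡⟨ ∑-distrib-+ (λ i → a * f i) (λ i → b * g i) ⟩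
  sum (λ i → a * f i) + sum (λ i → b * g i) ≡⟨ cong₂ _+_ (*-distribˡ-sum a f) (*-distribˡ-sum b g) ⟨
  a * sum f + b * sum g                   ∎

sum-zero : ∀ {f : Fin n → ℤ} → (∀ i → f i ≡ 0ℤ) → sum f ≡ 0ℤ
sum-zero {n} f≗0 = trans (sum-cong-≗ f≗0) (sum-replicate-zero n)

sign : Fin n → ℤ
sign j = -1ℤ ^ toℕ j

det-cong : {M N : Matrix n} → (∀ i j → M i j ≡ N i j) → det M ≡ det N
det-cong {zero}  M≗N = refl
det-cong {suc n} M≗N = sum-cong-≗ λ j → cong (sign j *_)
  (cong₂ _*_ (M≗N zero j) (det-cong λ i k → M≗N (suc i) (punchIn j k)))

-- Induction along the Laplace expansion. The term at `k` is linear through its entry in row zero,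
-- because its minor omits column `k`. Every other term is linear through its minor, where column
-- `k` sits at `punchOut j≢k`.
det-linear : (k : Fin n) (a b : ℤ) {M N P : Matrix n} →
             (∀ i → M i k ≡ a * N i k + b * P i k) →
             (∀ i l → l ≢ k → M i l ≡ N i l) →
             (∀ i l → l ≢ k → M i l ≡ P i l) →
             det M ≡ a * det N + b * det P
det-linear {suc n} k a b {M} {N} {P} Mk M≗N M≗P =
  trans (sum-cong-≗ term)
        (sum-linear a b (λ j → sign j * (N zero j * det (minor N j)))
                        (λ j → sign j * (P zero j * det (minor P j))))
  where
  expand-entry : ∀ s a b x y d → s * ((a * x + b * y) * d) ≡ a * (s * (x * d)) + b * (s * (y * d))
  expand-entry = solve-∀

  expand-minor : ∀ s a b x d e → s * (x * (a * d + b * e)) ≡ a * (s * (x * d)) + b * (s * (x * e))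
  expand-minor = solve-∀

  term : ∀ j → sign j * (M zero j * det (minor M j)) ≡
               a * (sign j * (N zero j * det (minor N j))) +
               b * (sign j * (P zero j * det (minor P j)))
  term j with j ≟ᶠ k
  ... | yes refl = begin
    sign j * (M zero j * det (minor M j))
      ≡⟨ cong (λ x → sign j * (x * det (minor M j))) (Mk zero) ⟩
    sign j * ((a * N zero j + b * P zero j) * det (minor M j))
      ≡⟨ expand-entry (sign j) a b (N zero j) (P zero j) (det (minor M j)) ⟩
    a * (sign j * (N zero j * det (minor M j))) + b * (sign j * (P zero j * det (minor M j)))
      ≡⟨ cong₂ (λ d e → a * (sign j * (N zero j * d)) + b * (sign j * (P zero j * e)))
               (det-cong λ i l → M≗N (suc i) (punchIn j l) (punchInᵢ≢i j l))
               (det-cong λ i l → M≗P (suc i) (punchIn j l) (punchInᵢ≢i j l)) ⟩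
    a * (sign j * (N zero j * det (minor N j))) + b * (sign j * (P zero j * det (minor P j))) ∎
  ... | no j≢k = begin
    sign j * (M zero j * det (minor M j))
      ≡⟨ cong (λ d → sign j * (M zero j * d)) (det-linear (punchOut j≢k) a b
           (λ i → subst (λ c → M (suc i) c ≡ a * N (suc i) c + b * P (suc i) c)
                        (sym (punchIn-punchOut j≢k)) (Mk (suc i)))
           (λ i l l≢ → M≗N (suc i) (punchIn j l) (other l≢))
           (λ i l l≢ → M≗P (suc i) (punchIn j l) (other l≢))) ⟩
    sign j * (M zero j * (a * det (minor N j) + b * det (minor P j)))
      ≡⟨ expand-minor (sign j) a b (M zero j) (det (minor N j)) (det (minor P j)) ⟩
    a * (sign j * (M zero j * det (minor N j))) + b * (sign j * (M zero j * det (minor P j)))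
      ≡⟨ cong₂ (λ x y → a * (sign j * (x * det (minor N j))) + b * (sign j * (y * det (minor P j))))
               (M≗N zero j j≢k) (M≗P zero j j≢k) ⟩
    a * (sign j * (N zero j * det (minor N j))) + b * (sign j * (P zero j * det (minor P j))) ∎
    where
    other : ∀ {l} → l ≢ punchOut j≢k → punchIn j l ≢ k
    other l≢ eq = l≢ (punchIn-injective j _ _ (trans eq (sym (punchIn-punchOut j≢k))))

-- Adjacent column swaps, and the determinant as an alternating form.

-- The transposition of `inject₁ k` and `suc k`, by recursion on `k` so that sums and minors can be
-- followed through the same recursion.
swap : Fin n → Fin (suc n) → Fin (suc n)
swap zero    zero          = suc zero
swap zero    (suc zero)    = zero
swap zero    (suc (suc j)) = suc (suc j)
swap (suc k) zero          = zero
swap (suc k) (suc j)       = suc (swap k j)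

swap-involutive : ∀ (k : Fin n) j → swap k (swap k j) ≡ j
swap-involutive zero    zero          = refl
swap-involutive zero    (suc zero)    = refl
swap-involutive zero    (suc (suc j)) = refl
swap-involutive (suc k) zero          = refl
swap-involutive (suc k) (suc j)       = cong suc (swap-involutive k j)

swap-suc : ∀ (k : Fin n) → swap k (suc k) ≡ inject₁ k
swap-suc zero    = refl
swap-suc (suc k) = cong suc (swap-suc k)

swap-inject₁ : ∀ (k : Fin n) → swap k (inject₁ k) ≡ suc k
swap-inject₁ zero    = refl
swap-inject₁ (suc k) = cong suc (swap-inject₁ k)

sum-swap : ∀ (k : Fin n) (f : Fin (suc n) → ℤ) → sum (f ∘ swap k) ≡ sum f
sum-swap zero    f = exchange (f (suc zero)) (f zero) (sum (λ j → f (suc (suc j))))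
  where
  exchange : ∀ a b c → a + (b + c) ≡ b + (a + c)
  exchange = solve-∀
sum-swap (suc k) f = cong (_+_ (f zero)) (sum-swap k (f ∘ suc))

-- Either swap k moves j, and then the minors at j and swap k j have the same columns, or it fixes
-- j and acts as an adjacent transposition on the columns of the minor at j.
data SwapMinor : Fin n → Fin (suc n) → Set where
  moved : ∀ {k : Fin n} {j} → sign (swap k j) ≡ - sign j →
          (∀ l → swap k (punchIn j l) ≡ punchIn (swap k j) l) → SwapMinor k j
  fixed : ∀ {k : Fin (suc n)} {j} (k′ : Fin n) → swap k j ≡ j →
          (∀ l → swap k (punchIn j l) ≡ punchIn j (swap k′ l)) → SwapMinor k j

swapMinor : ∀ (k : Fin n) j → SwapMinor k j
swapMinor zero zero = moved refl λ { zero → refl ; (suc l) → refl }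
swapMinor zero (suc zero) = moved refl λ { zero → refl ; (suc l) → refl }
swapMinor {suc (suc n)} zero (suc (suc j)) =
  fixed zero refl λ { zero → refl ; (suc zero) → refl ; (suc (suc l)) → refl }
swapMinor {suc (suc n)} (suc k) zero = fixed k refl λ l → refl
swapMinor (suc k) (suc j) with swapMinor k j
... | moved s p = moved (trans (cong (-1ℤ *_) s) (sym (neg-distribʳ-* -1ℤ (sign j))))
                        λ { zero → refl ; (suc l) → cong suc (p l) }
... | fixed k′ e p = fixed (suc k′) (cong suc e)
                        λ { zero → refl ; (suc l) → cong suc (p l) }

-- The expansion is reindexed along `swap k`. A moved term changes sign through its position, a
-- fixed one through its minor, by induction.
det-swap : ∀ (k : Fin n) (M : Matrix (suc n)) → det (λ i → M i ∘ swap k) ≡ - det M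
det-swap k M = begin
  det (λ i → M i ∘ swap k)       ≡⟨ sum-cong-≗ term ⟩
  sum (λ j → -1ℤ * t (swap k j)) ≡⟨ *-distribˡ-sum -1ℤ (t ∘ swap k) ⟨
  -1ℤ * sum (t ∘ swap k)         ≡⟨ cong (-1ℤ *_) (sum-swap k t) ⟩
  -1ℤ * det M                    ≡⟨ -1*i≡-i (det M) ⟩
  - det M                        ∎
  where
  t : Fin _ → ℤ
  t j = sign j * (M zero j * det (minor M j))

  flip-sign : ∀ s x d → s * (x * d) ≡ -1ℤ * (- s * (x * d))
  flip-sign = solve-∀

  flip-minor : ∀ s x d → s * (x * - d) ≡ -1ℤ * (s * (x * d))
  flip-minor = solve-∀

  term : ∀ j → sign j * (M zero (swap k j) * det (minor (λ i → M i ∘ swap k) j)) ≡ -1ℤ * t (swap k j)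
  term j with swapMinor k j
  ... | moved s p = begin
    sign j * (M zero (swap k j) * det (minor (λ i → M i ∘ swap k) j))
      ≡⟨ cong (λ d → sign j * (M zero (swap k j) * d))
              (det-cong λ i l → cong (M (suc i)) (p l)) ⟩
    sign j * (M zero (swap k j) * det (minor M (swap k j)))
      ≡⟨ flip-sign (sign j) (M zero (swap k j)) (det (minor M (swap k j))) ⟩
    -1ℤ * (- sign j * (M zero (swap k j) * det (minor M (swap k j))))
      ≡⟨ cong (λ s → -1ℤ * (s * (M zero (swap k j) * det (minor M (swap k j))))) s ⟨
    -1ℤ * t (swap k j) ∎
  ... | fixed k′ e p rewrite e = begin
    sign j * (M zero j * det (minor (λ i → M i ∘ swap k) j))
      ≡⟨ cong (λ d → sign j * (M zero j * d))
              (trans (det-cong λ i l → cong (M (suc i)) (p l)) (det-swap k′ (minor M j))) ⟩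
    sign j * (M zero j * - det (minor M j))
      ≡⟨ flip-minor (sign j) (M zero j) (det (minor M j)) ⟩
    -1ℤ * t j ∎

i≡-i⇒i≡0 : ∀ {i} → i ≡ - i → i ≡ 0ℤ
i≡-i⇒i≡0 {+ zero} _ = refl

-- If the equal columns are adjacent, swapping them changes nothing, so the determinant is its own
-- negative. Otherwise an adjacent swap brings the second copy one place closer to column zero, at
-- the cost of a sign.
det-alternating : ∀ (k : Fin n) (M : Matrix (suc n)) → (∀ i → M i zero ≡ M i (suc k)) → det M ≡ 0ℤ
det-alternating {suc n} = <-weakInduction _ base step
  where
  base : ∀ M → (∀ i → M i zero ≡ M i (suc zero)) → det M ≡ 0ℤ
  base M eq = i≡-i⇒i≡0 (trans (det-cong unchanged) (det-swap zero M))
    where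
    unchanged : ∀ i j → M i j ≡ M i (swap zero j)
    unchanged i zero          = eq i
    unchanged i (suc zero)    = sym (eq i)
    unchanged i (suc (suc j)) = refl
  step : ∀ (k : Fin n) → (∀ M → (∀ i → M i zero ≡ M i (suc (inject₁ k))) → det M ≡ 0ℤ) →
         ∀ M → (∀ i → M i zero ≡ M i (suc (suc k))) → det M ≡ 0ℤ
  step k ih M eq = neg-injective (trans (sym (det-swap (suc k) M)) (ih (λ i → M i ∘ swap (suc k))
    λ i → trans (eq i) (cong (M i ∘ suc) (sym (swap-inject₁ k)))))

-- Fraction-free elimination and its effect on the determinant.

-- Column operations with column zero that clear the rest of row zero.
clear : (Fin (suc m) → Fin (suc n) → ℤ) → Fin (suc m) → Fin (suc n) → ℤ
clear M i zero    = M i zero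
clear M i (suc k) = M zero zero * M i (suc k) + - M zero (suc k) * M i zero

-- The Schur complement of the entry `M zero zero`, scaled by that entry to stay integral.
schur : (Fin (suc m) → Fin (suc n) → ℤ) → Fin m → Fin n → ℤ
schur M i k = clear M (suc i) (suc k)

-- Columns are restored one at a time. By linearity in column `suc k`, the determinant is a
-- combination of one with that column restored and one where it repeats column zero; the latter
-- vanishes. When no cleared column is left, the matrix is `M`.
det-clear : (M : Matrix (suc n)) → det M ≡ 0ℤ → det (clear M) ≡ 0ℤ
det-clear {n} M det≡0 = go (allFin n) (clear M) (λ i → refl) (λ k → inj₂ (∈-allFin k , λ i → refl))
  where
  -- The columns of N are those of M or of clear M; ks lists the indices that may be cleared.
  go : ∀ ks (N : Matrix (suc n)) → (∀ i → N i zero ≡ M i zero) →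
       (∀ k → (∀ i → N i (suc k) ≡ M i (suc k)) ⊎ (k ∈ ks × ∀ i → N i (suc k) ≡ clear M i (suc k))) →
       det N ≡ 0ℤ
  go [] N N₀ N₊ = trans (det-cong {M = N} {M} λ { i zero → N₀ i ; i (suc k) → original k i }) det≡0
    where
    original : ∀ k i → N i (suc k) ≡ M i (suc k)
    original k with inj₁ eq ← N₊ k = eq
  go (k ∷ ks) N N₀ N₊ with N₊ k
  ... | inj₁ Nk = go ks N N₀ other
    where
    other : ∀ l → (∀ i → N i (suc l) ≡ M i (suc l)) ⊎ (l ∈ ks × ∀ i → N i (suc l) ≡ clear M i (suc l))
    other l with N₊ l
    ... | inj₁ eq               = inj₁ eq
    ... | inj₂ (here refl , _)  = inj₁ Nk
    ... | inj₂ (there l∈ , eq)  = inj₂ (l∈ , eq)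
  ... | inj₂ (_ , Nk) = begin
    det N                              ≡⟨ det-linear (suc k) p c
                                            (λ i → trans (Nk i) (sym (cong₂ (λ x y → p * x + c * y) (restored-k i) (doubled-k i))))
                                            (λ i l l≢k → sym (restored-≢k i l l≢k))
                                            (λ i l l≢k → sym (updateAt-minimal l (suc k) {f = const (M i zero)} (N i) l≢k)) ⟩
    p * det restored + c * det doubled ≡⟨ cong₂ (λ d e → p * d + c * e)
                                            (go ks restored N₀ other)
                                            (det-alternating k doubled λ i → trans (N₀ i) (sym (doubled-k i))) ⟩
    p * 0ℤ + c * 0ℤ                    ≡⟨ cong₂ _+_ (*-zeroʳ p) (*-zeroʳ c) ⟩
    0ℤ                                 ∎
    where
    p c : ℤ
    p = M zero zero
    c = - M zero (suc k)
    restored doubled : Matrix (suc n)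
    restored i = updateAt (N i) (suc k) (const (M i (suc k)))
    doubled  i = updateAt (N i) (suc k) (const (M i zero))

    restored-k : ∀ i → restored i (suc k) ≡ M i (suc k)
    restored-k i = updateAt-updates (suc k) {f = const (M i (suc k))} (N i)

    restored-≢k : ∀ i l → l ≢ suc k → restored i l ≡ N i l
    restored-≢k i l = updateAt-minimal l (suc k) {f = const (M i (suc k))} (N i)

    doubled-k : ∀ i → doubled i (suc k) ≡ M i zero
    doubled-k i = updateAt-updates (suc k) {f = const (M i zero)} (N i)

    other : ∀ l → (∀ i → restored i (suc l) ≡ M i (suc l)) ⊎
                  (l ∈ ks × ∀ i → restored i (suc l) ≡ clear M i (suc l))
    other l with l ≟ᶠ k
    ... | yes refl = inj₁ restored-k
    ... | no  l≢k with N₊ l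
    ...   | inj₁ eq              = inj₁ λ i → trans (restored-≢k i (suc l) λ { refl → l≢k refl }) (eq i)
    ...   | inj₂ (here l≡k , _)  = contradiction l≡k l≢k
    ...   | inj₂ (there l∈ , eq) = inj₂ (l∈ , λ i → trans (restored-≢k i (suc l) λ { refl → l≢k refl }) (eq i))

-- Row zero of `clear M` is zero off the pivot, so its determinant is the pivot times
-- `det (schur M)`, and a nonzero pivot can be cancelled.
det-schur : (M : Matrix (suc n)) → M zero zero ≢ 0ℤ → det M ≡ 0ℤ → det (schur M) ≡ 0ℤ
det-schur M p≢0 det≡0 with i*j≡0⇒i≡0∨j≡0 (M zero zero) (trans (sym expansion) (det-clear M det≡0))
  where
  cancel : ∀ a b → a * b + - b * a ≡ 0ℤ
  cancel = solve-∀

  vanish : ∀ s d → s * (0ℤ * d) ≡ 0ℤ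
  vanish = solve-∀

  expansion : det (clear M) ≡ M zero zero * det (schur M)
  expansion = begin
    1ℤ * (M zero zero * det (schur M)) +
      sum (λ j → sign (suc j) * (clear M zero (suc j) * det (minor (clear M) (suc j))))
                                                ≡⟨ cong₂ _+_ (*-identityˡ (M zero zero * det (schur M))) (sum-zero λ j →
      trans (cong (λ x → sign (suc j) * (x * det (minor (clear M) (suc j)))) (cancel (M zero zero) (M zero (suc j))))
            (vanish (sign (suc j)) (det (minor (clear M) (suc j))))) ⟩
    M zero zero * det (schur M) + 0ℤ            ≡⟨ +-identityʳ _ ⟩
    M zero zero * det (schur M)                 ∎
... | inj₁ p≡0 = contradiction p≡0 p≢0
... | inj₂ d≡0 = d≡0

-- Nonzero integer kernel vectors.

infix 7 _·_

_·_ : (Fin m → Fin n → ℤ) → (Fin n → ℤ) → Fin m → ℤ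
(M · x) i = sum λ j → M i j * x j

Kernel : (Fin m → Fin n → ℤ) → Set
Kernel {n = n} M = Σ[ x ∈ (Fin n → ℤ) ] (∃[ j ] x j ≢ 0ℤ) × (∀ i → (M · x) i ≡ 0ℤ)

-- Back substitution: `y` is scaled by the pivot, and the entry at zero is chosen to make row zero
-- vanish. The other rows of the product then become those of `schur M · y`.
kernel-schur : (M : Fin (suc m) → Fin (suc n) → ℤ) → M zero zero ≢ 0ℤ → Kernel (schur M) → Kernel M
kernel-schur {n = n} M p≢0 (y , (j , yj≢0) , My≡0) = x , (suc j , xj≢0) , Mx≡0
  where
  p : ℤ
  p = M zero zero
  T : Fin _ → ℤ
  T = (λ i k → M i (suc k)) · y
  x : Fin (suc n) → ℤ
  x zero    = - T zero
  x (suc k) = p * y k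

  xj≢0 : p * y j ≢ 0ℤ
  xj≢0 eq with i*j≡0⇒i≡0∨j≡0 p eq
  ... | inj₁ p≡0  = p≢0 p≡0
  ... | inj₂ yj≡0 = yj≢0 yj≡0

  pull : ∀ a b c → a * (b * c) ≡ b * (a * c)
  pull = solve-∀

  Mx : ∀ i → (M · x) i ≡ M i zero * - T zero + p * T i
  Mx i = cong (_+_ (M i zero * - T zero)) (trans (sum-cong-≗ λ k → pull (M i (suc k)) p (y k))
                                              (sym (*-distribˡ-sum p (λ k → M i (suc k) * y k))))

  distribute : ∀ p a b c y → (p * a + - b * c) * y ≡ p * (a * y) + - c * (b * y)
  distribute = solve-∀

  rearrange : ∀ a b c → a * - b + c ≡ c + - a * b
  rearrange = solve-∀

  cancel : ∀ a b → a * - b + a * b ≡ 0ℤ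
  cancel = solve-∀

  Mx≡0 : ∀ i → (M · x) i ≡ 0ℤ
  Mx≡0 zero    = trans (Mx zero) (cancel p (T zero))
  Mx≡0 (suc i) = begin
    (M · x) (suc i)                               ≡⟨ Mx (suc i) ⟩
    M (suc i) zero * - T zero + p * T (suc i)     ≡⟨ rearrange (M (suc i) zero) (T zero) (p * T (suc i)) ⟩
    p * T (suc i) + - M (suc i) zero * T zero     ≡⟨ sum-linear p (- M (suc i) zero) (λ k → M (suc i) (suc k) * y k) (λ k → M zero (suc k) * y k) ⟨
    sum (λ k → p * (M (suc i) (suc k) * y k) + - M (suc i) zero * (M zero (suc k) * y k))
                                                  ≡⟨ sum-cong-≗ (λ k → distribute p (M (suc i) (suc k)) (M zero (suc k)) (M (suc i) zero) (y k)) ⟨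
    (schur M · y) i                               ≡⟨ My≡0 i ⟩
    0ℤ                                            ∎

kernel-swap : (k : Fin n) (M : Fin m → Fin (suc n) → ℤ) → Kernel (λ i → M i ∘ swap k) → Kernel M
kernel-swap k M (y , (j , yj≢0) , My≡0) =
  y ∘ swap k , (swap k j , λ eq → yj≢0 (trans (cong y (sym (swap-involutive k j))) eq)) , λ i →
    trans (trans (sym (sum-swap k (λ j → M i j * y (swap k j))))
                 (sum-cong-≗ λ j → cong (λ l → M i (swap k j) * y l) (swap-involutive k j)))
          (My≡0 i)

-- Adjacent swaps carry a nonzero entry of row `r` to column zero, where elimination expects its
-- pivot. The property `Q` is left abstract so that it can also carry the hypothesis that the
-- determinant vanishes.
pivot-first : (Q : (Fin m → Fin (suc n) → ℤ) → Set) →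
              (∀ k M → Q (λ i → M i ∘ swap k) → Q M) →
              ∀ r → (∀ M → M r zero ≢ 0ℤ → Q M) →
              ∀ j M → M r j ≢ 0ℤ → Q M
pivot-first Q swapped r pivot = <-weakInduction _ pivot λ k ih M M≢0 →
  swapped k M (ih _ λ eq → M≢0 (trans (cong (M r) (sym (swap-inject₁ k))) eq))

nonzero? : (v : Fin n → ℤ) → (∃[ j ] v j ≢ 0ℤ) ⊎ (∀ j → v j ≡ 0ℤ)
nonzero? v with any? (λ j → ¬? (v j ≟ 0ℤ))
... | yes p = inj₁ p
... | no ¬p = inj₂ λ j → decidable-stable (v j ≟ 0ℤ) λ vj≢0 → ¬p (j , vj≢0)

-- A pivot in row zero allows elimination, which removes one row and one column. If row zero
-- vanishes, it is dropped together with column zero, and the vector found is padded with `0ℤ`.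
kernel-wide : (M : Fin n → Fin (suc n) → ℤ) → Kernel M
kernel-wide {zero}  M = const 1ℤ , (zero , λ ()) , λ ()
kernel-wide {suc n} M with nonzero? (M zero)
... | inj₁ (j , Mj≢0) =
  pivot-first Kernel kernel-swap zero (λ M p≢0 → kernel-schur M p≢0 (kernel-wide (schur M))) j M Mj≢0
... | inj₂ M₀≡0 with kernel-wide (λ i k → M (suc i) (suc k))
...   | y , (j , yj≢0) , My≡0 = x , (suc j , yj≢0) , Mx≡0
  where
  x : Fin (suc (suc n)) → ℤ
  x zero    = 0ℤ
  x (suc k) = y k

  Mx≡0 : ∀ i → (M · x) i ≡ 0ℤ
  Mx≡0 zero    = sum-zero λ j → cong (_* x j) (M₀≡0 j)
  Mx≡0 (suc i) = cong₂ _+_ (*-zeroʳ (M (suc i) zero)) (My≡0 i)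

-- Elimination keeps the determinant zero as long as row zero has a pivot. Once row zero vanishes,
-- the remaining rows form a matrix with more columns than rows. Size zero cannot occur, since the
-- empty determinant is 1.
kernel-singular : (M : Matrix n) → det M ≡ 0ℤ → Kernel M
kernel-singular {suc n} M det≡0 with nonzero? (M zero)
... | inj₁ (j , Mj≢0) =
  pivot-first (λ M → det M ≡ 0ℤ → Kernel M)
    (λ k M ker d → kernel-swap k M (ker (trans (det-swap k M) (cong -_ d)))) zero
    (λ M p≢0 d → kernel-schur M p≢0 (kernel-singular (schur M) (det-schur M p≢0 d)))
    j M Mj≢0 det≡0
... | inj₂ M₀≡0 with kernel-wide (M ∘ suc)
...   | x , x≢0 , Mx≡0 = x , x≢0 , λ where
  zero    → sum-zero λ j → cong (_* x j) (M₀≡0 j)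
  (suc i) → Mx≡0 i

-- Parity, and kernel vectors with an odd entry.

Even Odd : ℤ → Set
Even i = ∃[ c ] i ≡ + 2 * c
Odd  i = ∃[ c ] i ≡ 1ℤ + + 2 * c

even⊎odd : ∀ i → Even i ⊎ Odd i
even⊎odd i with i %ℕ 2 | n%ℕd<d i 2 | a≡a%ℕn+[a/ℕn]*n i 2
... | 0 | _ | eq = inj₁ (i /ℕ 2 , trans eq (commute (i /ℕ 2)))
  where
  commute : ∀ q → 0ℤ + q * + 2 ≡ + 2 * q
  commute = solve-∀
... | 1 | _ | eq = inj₂ (i /ℕ 2 , trans eq (cong (_+_ 1ℤ) (*-comm (i /ℕ 2) (+ 2))))
... | suc (suc _) | ℕ.s≤s (ℕ.s≤s ()) | _

allEven⊎anyOdd : (x : Fin n → ℤ) → (∀ j → Even (x j)) ⊎ (∃[ j ] Odd (x j))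
allEven⊎anyOdd {zero}  x = inj₁ λ ()
allEven⊎anyOdd {suc n} x with even⊎odd (x zero) | allEven⊎anyOdd (x ∘ suc)
... | inj₂ odd | _              = inj₂ (zero , odd)
... | inj₁ _   | inj₂ (j , odd) = inj₂ (suc j , odd)
... | inj₁ even | inj₁ evens    = inj₁ λ { zero → even ; (suc j) → evens j }

-- Descent: if all entries are even, half the vector is still in the kernel, and the nonzero entry
-- at the fixed index `j` has shrunk in absolute value. The bound `b` on that value makes the
-- recursion structural.
kernel-odd : (M : Fin m → Fin n → ℤ) → Kernel M →
             Σ[ x ∈ (Fin n → ℤ) ] (∃[ j ] Odd (x j)) × (∀ i → (M · x) i ≡ 0ℤ)
kernel-odd {n = n} M (x , (j , xj≢0) , Mx≡0) = halve ∣ x j ∣ x ℕ.≤-refl xj≢0 Mx≡0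
  where
  halve : ∀ b (x : Fin n → ℤ) → ∣ x j ∣ ℕ.≤ b → x j ≢ 0ℤ → (∀ i → (M · x) i ≡ 0ℤ) →
          Σ[ x ∈ (Fin n → ℤ) ] (∃[ j ] Odd (x j)) × (∀ i → (M · x) i ≡ 0ℤ)
  halve b x x≤b xj≢0 Mx≡0 with allEven⊎anyOdd x
  ... | inj₂ odd = x , odd , Mx≡0
  halve zero x x≤b xj≢0 Mx≡0 | inj₁ even = contradiction (∣i∣≡0⇒i≡0 (ℕ.n≤0⇒n≡0 x≤b)) xj≢0
  halve (suc b) x x≤b xj≢0 Mx≡0 | inj₁ even = halve b y (ℕ.≤-pred (ℕ.≤-trans ∣y∣<∣x∣ x≤b)) yj≢0 My≡0
    where
    y : Fin n → ℤ
    y = proj₁ ∘ even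

    x≡2y : ∀ l → x l ≡ + 2 * y l
    x≡2y = proj₂ ∘ even

    yj≢0 : y j ≢ 0ℤ
    yj≢0 eq = xj≢0 (trans (x≡2y j) (cong (_*_ (+ 2)) eq))

    ∣y∣<∣x∣ : ∣ y j ∣ ℕ.< ∣ x j ∣
    ∣y∣<∣x∣ = subst (∣ y j ∣ ℕ.<_) (sym (trans (cong ∣_∣ (x≡2y j)) (abs-* (+ 2) (y j))))
      -- Here `2 ℕ.* ∣ y j ∣` unfolds to `∣ y j ∣ ℕ.+ (∣ y j ∣ ℕ.+ 0)`, whose second summand is
      -- positive.
      (ℕ.m<m+n ∣ y j ∣ (ℕ.<-≤-trans (ℕ.n≢0⇒n>0 (yj≢0 ∘ ∣i∣≡0⇒i≡0)) (ℕ.m≤m+n ∣ y j ∣ 0)))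

    pull : ∀ a c → a * (+ 2 * c) ≡ + 2 * (a * c)
    pull = solve-∀

    My≡0 : ∀ i → (M · y) i ≡ 0ℤ
    My≡0 i = *-cancelˡ-≡ (+ 2) ((M · y) i) 0ℤ (begin
      + 2 * (M · y) i                    ≡⟨ *-distribˡ-sum (+ 2) (λ l → M i l * y l) ⟩
      sum (λ l → + 2 * (M i l * y l))    ≡⟨ sum-cong-≗ (λ l → pull (M i l) (y l)) ⟨
      sum (λ l → M i l * (+ 2 * y l))    ≡⟨ sum-cong-≗ (λ l → cong (_*_ (M i l)) (x≡2y l)) ⟨
      (M · x) i                          ≡⟨ Mx≡0 i ⟩
      0ℤ                                 ∎)

-- Counting by sums of indicators.

𝟙 : {P : Set} → Dec P → ℤ
𝟙 P? = if does P? then 1ℤ else 0ℤ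

sum-identity : (x : Fin n → ℤ) (i : Fin n) → (identity n · x) i ≡ x i
sum-identity x zero = trans (cong₂ _+_ (*-identityˡ (x zero)) (sum-zero {f = λ j → 0ℤ * x (suc j)} λ j → refl)) (+-identityʳ (x zero))
sum-identity x (suc i) = trans (cong (_+_ 0ℤ) (sum-identity (x ∘ suc) i)) (+-identityˡ (x (suc i)))

length-filter-tabulate : {A : Set} {P : A → Set} (P? : Decidable P) (f : Fin n → A) →
                         + length (filter P? (tabulate f)) ≡ sum (λ i → 𝟙 (P? (f i)))
length-filter-tabulate {zero}  P? f = refl
length-filter-tabulate {suc n} P? f with does (P? (f zero)) | length-filter-tabulate P? (f ∘ suc)
... | true  | ih = cong (_+_ 1ℤ) ih
... | false | ih = trans ih (sym (+-identityˡ _))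

length-filter-cartesianProduct : {A B : Set} {P : A × B → Set} (P? : Decidable P) (f : Fin m → A) (g : Fin n → B) →
  + length (filter P? (cartesianProduct (tabulate f) (tabulate g))) ≡ sum (λ i → sum (λ j → 𝟙 (P? (f i , g j))))
length-filter-cartesianProduct {zero}  P? f g = refl
length-filter-cartesianProduct {suc m} P? f g = begin
  + length (filter P? (row ++ rest))                      ≡⟨ cong (+_ ∘ length) (filter-++ P? row rest) ⟩
  + length (filter P? row ++ filter P? rest)              ≡⟨ cong +_ (length-++ (filter P? row)) ⟩
  + (length (filter P? row) ℕ.+ length (filter P? rest))  ≡⟨ pos-+ (length (filter P? row)) (length (filter P? rest)) ⟩
  + length (filter P? row) + + length (filter P? rest)    ≡⟨ cong₂ _+_
      (trans (cong (λ xs → + length (filter P? xs)) (map-tabulate g (f zero ,_)))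
             (length-filter-tabulate P? (λ j → f zero , g j)))
      (length-filter-cartesianProduct P? (f ∘ suc) g) ⟩
  sum (λ i → sum (λ j → 𝟙 (P? (f i , g j))))              ∎
  where
  row  = map (f zero ,_) (tabulate g)
  rest = cartesianProduct (tabulate (f ∘ suc)) (tabulate g)

-- By trichotomy, `B` is its strict upper triangle `U` plus the transpose of `U`, and exchanging the
-- order of summation shows that both have the same total. This serves the handshake lemma as well
-- as the evenness of the quadratic form.
sum-symmetric : (B : Matrix n) → (∀ i j → B i j ≡ B j i) → (∀ i → B i i ≡ 0ℤ) →
                sum (λ i → sum (B i)) ≡ + 2 * sum (λ i → sum (λ j → 𝟙 (i <? j) * B i j))
sum-symmetric {n} B B-sym B-diag = begin
  sum (λ i → sum (B i))                      ≡⟨ sum-cong-≗ (λ i → trans (sum-cong-≗ (split i)) (∑-distrib-+ (U i) (λ j → U j i))) ⟩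
  sum (λ i → sum (U i) + sum (λ j → U j i))  ≡⟨ ∑-distrib-+ (λ i → sum (U i)) (λ i → sum (λ j → U j i)) ⟩
  u + sum (λ i → sum (λ j → U j i))          ≡⟨ cong (_+_ u) (∑-comm (λ i j → U j i)) ⟩
  u + u                                      ≡⟨ double u ⟩
  + 2 * u                                    ∎
  where
  U : Matrix n
  U i j = 𝟙 (i <? j) * B i j
  u : ℤ
  u = sum (λ i → sum (U i))

  double : ∀ u → u + u ≡ + 2 * u
  double = solve-∀

  first : ∀ b c → b ≡ 1ℤ * b + 0ℤ * c
  first = solve-∀

  second : ∀ b c → c ≡ 0ℤ * b + 1ℤ * c
  second = solve-∀

  split : ∀ i j → B i j ≡ U i j + U j i
  split i j with <-cmp i j
  ... | tri< i<j _ j≮i rewrite dec-true (i <? j) i<j | dec-false (j <? i) j≮i = first (B i j) (B j i)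
  ... | tri≈ _ refl _ rewrite B-diag i with does (i <? i)
  ...   | true  = refl
  ...   | false = refl
  split i j | tri> i≮j _ j<i rewrite dec-false (i <? j) i≮j | dec-true (j <? i) j<i =
    trans (B-sym i j) (second (B i j) (B j i))

-- Bilinear and quadratic forms of symmetric matrices.

⟨_,_⟩ : (Fin n → ℤ) → (Fin n → ℤ) → ℤ
⟨ x , y ⟩ = sum λ i → x i * y i

rotate : ∀ x a y → x * (a * y) ≡ y * (a * x)
rotate = solve-∀

self-adjoint : (A : Matrix n) → (∀ i j → A i j ≡ A j i) → ∀ x y → ⟨ x , A · y ⟩ ≡ ⟨ A · x , y ⟩
self-adjoint A A-sym x y = begin
  sum (λ i → x i * sum (λ j → A i j * y j))   ≡⟨ sum-cong-≗ (λ i → *-distribˡ-sum (x i) (λ j → A i j * y j)) ⟩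
  sum (λ i → sum (λ j → x i * (A i j * y j))) ≡⟨ ∑-comm (λ i j → x i * (A i j * y j)) ⟩
  sum (λ j → sum (λ i → x i * (A i j * y j))) ≡⟨ sum-cong-≗ (λ j → sum-cong-≗ λ i →
                                                    trans (cong (λ a → x i * (a * y j)) (A-sym i j)) (rotate (x i) (A j i) (y j))) ⟩
  sum (λ j → sum (λ i → y j * (A j i * x i))) ≡⟨ sum-cong-≗ (λ j → *-distribˡ-sum (y j) (λ i → A j i * x i)) ⟨
  sum (λ j → y j * sum (λ i → A j i * x i))   ≡⟨ sum-cong-≗ (λ j → *-comm (y j) ((A · x) j)) ⟩
  sum (λ j → (A · x) j * y j)                 ∎

-- The matrix with entries `x i * (A i j * x j)` is symmetric with zero diagonal, so its total is
-- twice that of its upper triangle.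
quadratic-form-even : (A : Matrix n) → (∀ i j → A i j ≡ A j i) → (∀ i → A i i ≡ 0ℤ) →
                      ∀ x → Even ⟨ x , A · x ⟩
quadratic-form-even A A-sym A-diag x = _ , trans
  (sum-cong-≗ λ i → *-distribˡ-sum (x i) (λ j → A i j * x j))
  (sum-symmetric (λ i j → x i * (A i j * x j))
    (λ i j → trans (cong (λ a → x i * (a * x j)) (A-sym i j)) (rotate (x i) (A j i) (x j)))
    (λ i → trans (cong (λ a → x i * (a * x i)) (A-diag i)) (vanish (x i))))
  where
  vanish : ∀ x → x * (0ℤ * x) ≡ 0ℤ
  vanish = solve-∀

-- Arithmetic modulo 4 and 16.

-- With `u` the half of `d` rounded down, the witness is `u * u - u` for even `d` and `u * u` for
-- odd `d`. The indicator is what later sums to the number of odd vertices.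
square-mod-4 : ∀ d → ∃[ w ] + d * + d ≡ + 2 * + d + - 𝟙 (d % 2 ℕ.≟ 1) + + 4 * w
square-mod-4 d with d % 2 | m%n<n d 2 | m≡m%n+[m/n]*n d 2
... | 0 | _ | eq = u * u - u , subst (λ e → e * e ≡ + 2 * e + 0ℤ + + 4 * (u * u - u)) (sym (pos eq)) (square u)
  where
  u : ℤ
  u = + (d ℕ./ 2)

  pos : d ≡ d ℕ./ 2 ℕ.* 2 → + d ≡ u * + 2
  pos eq = trans (cong +_ eq) (pos-* (d ℕ./ 2) 2)

  square : ∀ u → (u * + 2) * (u * + 2) ≡ + 2 * (u * + 2) + 0ℤ + + 4 * (u * u - u)
  square = solve-∀
... | 1 | _ | eq = u * u , subst (λ e → e * e ≡ + 2 * e + -1ℤ + + 4 * (u * u)) (sym (pos eq)) (square u)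
  where
  u : ℤ
  u = + (d ℕ./ 2)

  pos : d ≡ 1 ℕ.+ d ℕ./ 2 ℕ.* 2 → + d ≡ 1ℤ + u * + 2
  pos eq = trans (cong +_ eq) (trans (pos-+ 1 (d ℕ./ 2 ℕ.* 2)) (cong (_+_ 1ℤ) (pos-* (d ℕ./ 2) 2)))

  square : ∀ u → (1ℤ + u * + 2) * (1ℤ + u * + 2) ≡ + 2 * (1ℤ + u * + 2) + -1ℤ + + 4 * (u * u)
  square = solve-∀
... | suc (suc _) | ℕ.s≤s (ℕ.s≤s ()) | _

-- The expansion of s = 1ᵀ (I + 2A)⁻¹ (s 1) in powers of 2, where tₖ = 1ᵀ Aᵏ x.
expand-mod-16 : ∀ s n m o w e t₁ t₂ t₃ t₄ →
  s  ≡ s * n + - + 2 * t₁ →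
  t₁ ≡ s * (+ 2 * m) + - + 2 * t₂ →
  t₂ ≡ s * (+ 4 * m + - o + + 4 * w) + - + 2 * t₃ →
  t₃ ≡ s * (+ 2 * e) + - + 2 * t₄ →
  s * (n - 1ℤ - + 4 * (m + o)) ≡ + 16 * (s * e - t₄ - s * (m + w))
expand-mod-16 s n m o w e t₁ t₂ t₃ t₄ s≡ refl refl refl = begin
  -- Chaining the equations gives `m` the coefficient - 4 + 16 times `s`. The 16 and the other
  -- multiples of 16 are collected in `r`.
  s * (n - 1ℤ - + 4 * (m + o))  ≡⟨ complete s n m o w e t₄ ⟩
  s * n + - + 2 * t₁ - s + r    ≡⟨ cong (λ a → a - s + r) s≡ ⟨
  s - s + r                     ≡⟨ drop s r ⟩
  r                             ∎
  where
  r : ℤ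
  r = + 16 * (s * e - t₄ - s * (m + w))

  complete : ∀ s n m o w e t → s * (n - 1ℤ - + 4 * (m + o)) ≡
    (s * n + - + 2 * (s * (+ 2 * m) + - + 2 * (s * (+ 4 * m + - o + + 4 * w) + - + 2 * (s * (+ 2 * e) + - + 2 * t)))) - s
      + + 16 * (s * e - t - s * (m + w))
  complete = solve-∀

  drop : ∀ s r → s - s + r ≡ r
  drop = solve-∀

-- Degree sums of a graph and the kernel of its Seidel matrix.

module GraphProperties (G : Graph n) where
  open Graph G renaming (adjacency to A; sym to ~-sym)

  A-sym : ∀ i j → A i j ≡ A j i
  A-sym i j = cong (if_then 1ℤ else 0ℤ) (does-⇔ (mk⇔ ~-sym ~-sym) (i ~? j) (j ~? i))

  A-diag : ∀ i → A i i ≡ 0ℤ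
  A-diag i = cong (if_then 1ℤ else 0ℤ) (dec-false (i ~? i) (irrefl refl))

  𝟏 : Fin n → ℤ
  𝟏 _ = 1ℤ

  sum-A : ∀ i → sum (A i) ≡ + degree i
  sum-A i = sym (length-filter-tabulate (i ~?_) id)

  A·𝟏 : ∀ i → (A · 𝟏) i ≡ + degree i
  A·𝟏 i = trans (sum-cong-≗ λ j → *-identityʳ (A i j)) (sum-A i)

  -- The upper triangle of `A` counts the pairs with `i < j`, just as `edges` lists them.
  handshake : sum (λ i → + degree i) ≡ + 2 * + size
  handshake = begin
    sum (λ i → + degree i)                                   ≡⟨ sum-cong-≗ sum-A ⟨
    sum (λ i → sum (A i))                                    ≡⟨ sum-symmetric A A-sym A-diag ⟩
    + 2 * sum (λ i → sum (λ j → 𝟙 (i <? j) * A i j))         ≡⟨ cong (_*_ (+ 2)) (sum-cong-≗ λ i → sum-cong-≗ λ j → 𝟙-×-dec i j) ⟩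
    + 2 * sum (λ i → sum (λ j → 𝟙 ((i <? j) ×-dec (i ~? j)))) ≡⟨ cong (_*_ (+ 2)) (length-filter-cartesianProduct (λ (i , j) → (i <? j) ×-dec (i ~? j)) id id) ⟨
    + 2 * + size                                             ∎
    where
    𝟙-×-dec : ∀ i j → 𝟙 (i <? j) * A i j ≡ 𝟙 ((i <? j) ×-dec (i ~? j))
    𝟙-×-dec i j with does (i <? j) | does (i ~? j)
    ... | false | _     = refl
    ... | true  | false = refl
    ... | true  | true  = refl

  -- `square-mod-4` is summed over the vertices: the linear terms give `4 * size` by the handshake
  -- lemma, and the indicators give `n-odd`.
  sum-degree² : ∃[ w ] sum (λ i → + degree i * + degree i) ≡ + 4 * + size + - + n-odd + + 4 * w
  sum-degree² = sum w , (begin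
    sum (λ i → + degree i * + degree i)                             ≡⟨ sum-cong-≗ (proj₂ ∘ square-mod-4 ∘ degree) ⟩
    sum (λ i → + 2 * + degree i + - o i + + 4 * w i)                ≡⟨ sum-cong-≗ (λ i → regroup (+ degree i) (o i) (w i)) ⟩
    sum (λ i → + 2 * + degree i + 1ℤ * (-1ℤ * o i + + 4 * w i))     ≡⟨ sum-linear (+ 2) 1ℤ (λ i → + degree i) (λ i → -1ℤ * o i + + 4 * w i) ⟩
    + 2 * sum (λ i → + degree i) + 1ℤ * sum (λ i → -1ℤ * o i + + 4 * w i)
      ≡⟨ cong₂ (λ a b → + 2 * a + 1ℤ * b) handshake (sum-linear -1ℤ (+ 4) o w) ⟩
    + 2 * (+ 2 * + size) + 1ℤ * (-1ℤ * sum o + + 4 * sum w)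
      ≡⟨ cong (λ a → + 2 * (+ 2 * + size) + 1ℤ * (-1ℤ * a + + 4 * sum w)) (length-filter-tabulate (λ i → degree i % 2 ℕ.≟ 1) id) ⟨
    + 2 * (+ 2 * + size) + 1ℤ * (-1ℤ * + n-odd + + 4 * sum w)       ≡⟨ collect (+ size) (+ n-odd) (sum w) ⟩
    + 4 * + size + - + n-odd + + 4 * sum w                          ∎)
    where
    o w : Fin n → ℤ
    o i = 𝟙 (degree i % 2 ℕ.≟ 1)
    w i = proj₁ (square-mod-4 (degree i))

    regroup : ∀ d o w → + 2 * d + - o + + 4 * w ≡ + 2 * d + 1ℤ * (-1ℤ * o + + 4 * w)
    regroup = solve-∀

    collect : ∀ m o w → + 2 * (+ 2 * m) + 1ℤ * (-1ℤ * o + + 4 * w) ≡ + 4 * m + - o + + 4 * w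
    collect = solve-∀

  d Ad : Fin n → ℤ
  d  = A · 𝟏
  Ad = A · d

  -- Summing is pairing with `𝟏`, and moving `A` onto `𝟏` gives `d`. So the sum of `Ad` becomes the
  -- sum of squared degrees, and that of `A · Ad` becomes the quadratic form of `A` at `d`.
  sum-A· : ∀ v → sum (A · v) ≡ ⟨ d , v ⟩
  sum-A· v = trans (sum-cong-≗ λ i → sym (*-identityˡ ((A · v) i))) (self-adjoint A A-sym 𝟏 v)

  sum-d : sum d ≡ + 2 * + size
  sum-d = trans (sum-cong-≗ A·𝟏) handshake

  sum-Ad : sum Ad ≡ + 4 * + size + - + n-odd + + 4 * proj₁ sum-degree²
  sum-Ad = trans (sum-A· d) (trans (sum-cong-≗ λ i → cong₂ _*_ (A·𝟏 i) (A·𝟏 i)) (proj₂ sum-degree²))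

  sum-AAd : Even (sum (A · Ad))
  sum-AAd with e , eq ← quadratic-form-even A A-sym A-diag d = e , trans (sum-A· Ad) eq

  sum-𝟏 : ∀ {n} → sum {n} (λ _ → 1ℤ) ≡ + n
  sum-𝟏 {zero}  = refl
  sum-𝟏 {suc n} = cong (_+_ 1ℤ) (sum-𝟏 {n})

  seidel-· : ∀ x i → (seidel G · x) i ≡ sum x - x i - + 2 * (A · x) i
  seidel-· x i = begin
    sum (λ j → (1ℤ - identity n i j - + 2 * A i j) * x j)
      ≡⟨ sum-cong-≗ (λ j → regroup (identity n i j) (A i j) (x j)) ⟩
    sum (λ j → 1ℤ * (1ℤ * x j + -1ℤ * (identity n i j * x j)) + - + 2 * (A i j * x j))
      ≡⟨ sum-linear 1ℤ (- + 2) (λ j → 1ℤ * x j + -1ℤ * (identity n i j * x j)) (λ j → A i j * x j) ⟩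
    1ℤ * sum (λ j → 1ℤ * x j + -1ℤ * (identity n i j * x j)) + - + 2 * (A · x) i
      ≡⟨ cong (λ a → 1ℤ * a + - + 2 * (A · x) i) (sum-linear 1ℤ -1ℤ x (λ j → identity n i j * x j)) ⟩
    1ℤ * (1ℤ * sum x + -1ℤ * (identity n · x) i) + - + 2 * (A · x) i
      ≡⟨ cong (λ a → 1ℤ * (1ℤ * sum x + -1ℤ * a) + - + 2 * (A · x) i) (sum-identity x i) ⟩
    1ℤ * (1ℤ * sum x + -1ℤ * x i) + - + 2 * (A · x) i
      ≡⟨ collect (sum x) (x i) ((A · x) i) ⟩
    sum x - x i - + 2 * (A · x) i ∎
    where
    regroup : ∀ e a x → (1ℤ - e - + 2 * a) * x ≡ 1ℤ * (1ℤ * x + -1ℤ * (e * x)) + - + 2 * (a * x)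
    regroup = solve-∀

    collect : ∀ s x y → 1ℤ * (1ℤ * s + -1ℤ * x) + - + 2 * y ≡ s - x - + 2 * y
    collect = solve-∀

  module _ (x : Fin n → ℤ) (Sx≡0 : ∀ i → (seidel G · x) i ≡ 0ℤ) where

    s : ℤ
    s = sum x

    x≡s-2Ax : ∀ i → x i ≡ s + - + 2 * (A · x) i
    x≡s-2Ax i = begin
      x i                                       ≡⟨ isolate s (x i) ((A · x) i) ⟩
      s + - + 2 * (A · x) i - (s - x i - + 2 * (A · x) i)
        ≡⟨ cong (λ a → s + - + 2 * (A · x) i - a) (trans (sym (seidel-· x i)) (Sx≡0 i)) ⟩
      s + - + 2 * (A · x) i - 0ℤ                ≡⟨ +-identityʳ (s + - + 2 * (A · x) i) ⟩
      s + - + 2 * (A · x) i                     ∎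
      where
      isolate : ∀ s x y → x ≡ s + - + 2 * y - (s - x - + 2 * y)
      isolate = solve-∀

    -- The equation for `x` is paired with `v`, and `A` is moved from `x` to `v`. The same rule then
    -- applies to `A · v`, which yields the expansion in powers of 2.
    pair-x : ∀ v → ⟨ v , x ⟩ ≡ s * sum v + - + 2 * ⟨ A · v , x ⟩
    pair-x v = begin
      sum (λ i → v i * x i)                                 ≡⟨ sum-cong-≗ (λ i → cong (_*_ (v i)) (x≡s-2Ax i)) ⟩
      sum (λ i → v i * (s + - + 2 * (A · x) i))             ≡⟨ sum-cong-≗ (λ i → distribute (v i) s ((A · x) i)) ⟩
      sum (λ i → s * v i + - + 2 * (v i * (A · x) i))       ≡⟨ sum-linear s (- + 2) v (λ i → v i * (A · x) i) ⟩
      s * sum v + - + 2 * ⟨ v , A · x ⟩                     ≡⟨ cong (λ a → s * sum v + - + 2 * a) (self-adjoint A A-sym v x) ⟩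
      s * sum v + - + 2 * ⟨ A · v , x ⟩                     ∎
      where
      distribute : ∀ v s y → v * (s + - + 2 * y) ≡ s * v + - + 2 * (v * y)
      distribute = solve-∀

    -- Every entry of `x` differs from `s` by an even number, so one odd entry suffices.
    sum-odd : ∃[ j ] Odd (x j) → Odd s
    sum-odd (j , c , xj≡) = c + (A · x) j , (begin
      s                                     ≡⟨ isolate s ((A · x) j) ⟩
      s + - + 2 * (A · x) j + + 2 * (A · x) j ≡⟨ cong (λ a → a + + 2 * (A · x) j) (trans (sym (x≡s-2Ax j)) xj≡) ⟩
      1ℤ + + 2 * c + + 2 * (A · x) j        ≡⟨ collect c ((A · x) j) ⟩
      1ℤ + + 2 * (c + (A · x) j)            ∎)
      where
      isolate : ∀ s y → s ≡ s + - + 2 * y + + 2 * y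
      isolate = solve-∀

      collect : ∀ c y → 1ℤ + + 2 * c + + 2 * y ≡ 1ℤ + + 2 * (c + y)
      collect = solve-∀

    16∣s*excess : ∃[ r ] s * (+ n - 1ℤ - + 4 * (+ size + + n-odd)) ≡ + 16 * r
    16∣s*excess = _ , expand-mod-16 s (+ n) (+ size) (+ n-odd) w e
      ⟨ d , x ⟩ ⟨ Ad , x ⟩ ⟨ A · Ad , x ⟩ ⟨ A · (A · Ad) , x ⟩
      -- `pair-x` is applied to `𝟏` and its first three images under `A`. The initial `trans`
      -- rewrites `s` as the pairing of `𝟏` with `x`.
      (trans (sum-cong-≗ λ i → sym (*-identityˡ (x i))) (step 𝟏 (+ n) sum-𝟏))
      (step d (+ 2 * + size) sum-d)
      (step Ad (+ 4 * + size + - + n-odd + + 4 * w) sum-Ad)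
      (step (A · Ad) (+ 2 * e) (proj₂ sum-AAd))
      where
      w e : ℤ
      w = proj₁ sum-degree²
      e = proj₁ sum-AAd

      step : ∀ v σ → sum v ≡ σ → ⟨ v , x ⟩ ≡ s * σ + - + 2 * ⟨ A · v , x ⟩
      step v σ p = trans (pair-x v) (cong (λ a → s * a + - + 2 * ⟨ A · v , x ⟩) p)

-- Cancelling the odd factor and returning to natural numbers.

-- Odd integers are units modulo 16; factoring a difference of fourth powers gives an explicit
-- inverse.
odd-cancel-16 : ∀ {s} → Odd s → ∀ y r → s * y ≡ + 16 * r → ∃[ z ] y ≡ + 16 * z
odd-cancel-16 {s} (b , refl) y r sy≡16r = _ , (begin
  y                                                                       ≡⟨ invert b y ⟩
  (1ℤ + + 2 * b) * y * inverse + + 16 * (b * b * b * b * y)               ≡⟨ cong (λ a → a * inverse + + 16 * (b * b * b * b * y)) sy≡16r ⟩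
  + 16 * r * inverse + + 16 * (b * b * b * b * y)                         ≡⟨ collect r inverse (b * b * b * b * y) ⟩
  + 16 * (r * inverse + b * b * b * b * y)                                ∎)
  where
  -- (1 + 2b) * inverse = 1 − 16b⁴.
  inverse : ℤ
  inverse = (1ℤ - + 2 * b) * (1ℤ + + 4 * (b * b))

  invert : ∀ b y → y ≡ (1ℤ + + 2 * b) * y * ((1ℤ - + 2 * b) * (1ℤ + + 4 * (b * b))) + + 16 * (b * b * b * b * y)
  invert = solve-∀

  collect : ∀ r i c → + 16 * r * i + + 16 * c ≡ + 16 * (r * i + c)
  collect = solve-∀

-- Remainders are taken in the natural numbers, so a negative multiple of 4 is first moved to the
-- other side.
%-shift-4 : ∀ q M z → + q ≡ + M + + 4 * z → M % 4 ≡ q % 4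
%-shift-4 q M (+ z) eq = trans (sym ([m+kn]%n≡m%n M z 4)) (cong (_% 4) (sym (+-injective (begin
  + q                 ≡⟨ eq ⟩
  + M + + 4 * + z     ≡⟨ cong (_+_ (+ M)) (trans (*-comm (+ 4) (+ z)) (sym (pos-* z 4))) ⟩
  + M + + (z ℕ.* 4)   ≡⟨ pos-+ M (z ℕ.* 4) ⟨
  + (M ℕ.+ z ℕ.* 4)   ∎))))
%-shift-4 q M -[1+ z ] eq = trans (cong (_% 4) (+-injective (begin
  + M                       ≡⟨ isolate (+ M) (+ suc z) ⟩
  (+ M + + 4 * - + suc z) + + suc z * + 4 ≡⟨ cong₂ _+_ (sym eq) (sym (pos-* (suc z) 4)) ⟩
  + q + + (suc z ℕ.* 4)     ≡⟨ pos-+ q (suc z ℕ.* 4) ⟨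
  + (q ℕ.+ suc z ℕ.* 4)     ∎))) ([m+kn]%n≡m%n q (suc z) 4)
  where
  isolate : ∀ m z → m ≡ (m + + 4 * - z) + z * + 4
  isolate = solve-∀

-- The hypothesis rearranges to `k` being 4 times `M + 4z`. This gives the divisibility, and
-- cancelling 4 identifies the quotient with `M + 4z`.
quotient-mod-4 : ∀ k M z → + suc k - 1ℤ - + 4 * + M ≡ + 16 * z →
                 Σ[ 4∣k ∈ 4 ∣ k ] M % 4 ≡ quotient 4∣k % 4
quotient-mod-4 k M z eq = 4∣k , %-shift-4 (quotient 4∣k) M z (*-cancelʳ-≡ (+ quotient 4∣k) (+ M + + 4 * z) (+ 4) (begin
  + quotient 4∣k * + 4      ≡⟨ pos-* (quotient 4∣k) 4 ⟨
  + (quotient 4∣k ℕ.* 4)    ≡⟨ cong +_ (_∣_.equality 4∣k) ⟨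
  + k                       ≡⟨ k≡ ⟩
  (+ M + + 4 * z) * + 4     ∎))
  where
  -- The summand `1ℤ + k` has this form because `1ℤ + + k` computes to `+ suc k`.
  isolate : ∀ k m → k ≡ 1ℤ + k - 1ℤ - + 4 * m + + 4 * m
  isolate = solve-∀

  collect : ∀ m z → + 16 * z + + 4 * m ≡ (m + + 4 * z) * + 4
  collect = solve-∀

  k≡ : + k ≡ (+ M + + 4 * z) * + 4
  k≡ = begin
    + k                                       ≡⟨ isolate (+ k) (+ M) ⟩
    + suc k - 1ℤ - + 4 * + M + + 4 * + M      ≡⟨ cong (λ a → a + + 4 * + M) eq ⟩
    + 16 * z + + 4 * + M                      ≡⟨ collect (+ M) z ⟩
    (+ M + + 4 * z) * + 4                     ∎

  4∣k : 4 ∣ k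
  4∣k = ∣⇒∣ᵤ (divides (+ M + + 4 * z) k≡)

theorem3p5 : ∀ (n : ℕ) .{{_ : NonZero n}} (G : Graph n) →
    Singular (seidel G) →
    Σ[ 4∣n-1 ∈ 4 ∣ n ∸ 1 ]
    (Graph.size G ℕ.+ Graph.n-odd G) % 4 ≡ quotient 4∣n-1 % 4
theorem3p5 (suc k) G singular =
  conclude (kernel-odd (seidel G) (kernel-singular (seidel G) singular))
  where
  open Graph G using (size; n-odd)
  open GraphProperties G using (sum-odd; 16∣s*excess)

  excess : ℤ
  excess = + suc k - 1ℤ - + 4 * + (size ℕ.+ n-odd)

  conclude : Σ[ x ∈ (Fin (suc k) → ℤ) ] (∃[ j ] Odd (x j)) × (∀ i → (seidel G · x) i ≡ 0ℤ) →
             Σ[ 4∣k ∈ 4 ∣ k ] (size ℕ.+ n-odd) % 4 ≡ quotient 4∣k % 4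
  conclude (x , odd , Sx≡0) = quotient-mod-4 k (size ℕ.+ n-odd) (proj₁ 16∣excess) (proj₂ 16∣excess)
    where
    16∣excess : ∃[ z ] excess ≡ + 16 * z
    16∣excess = odd-cancel-16 {sum x} (sum-odd x Sx≡0 odd) excess
      (proj₁ (16∣s*excess x Sx≡0)) (proj₂ (16∣s*excess x Sx≡0))
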